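{- $\{\omega \cdot 2, \omega^\star \cdot 2\} \leq_c \{\omega^2, (\omega^2)^\star\}$.
   Context: Structures have domains contained in $\omega$. For countable structures $\mathcal{A},\mathcal{B}$, the class $\{\mathcal{A},\mathcal{B}\}$ denotes the class of all structures (with domain $\subseteq\omega$) isomorphic to $\mathcal{A}$ or to $\mathcal{B}$. Linear orders are in the language $\{<\}$; $L^\star$ is the reverse of a linear order $L$; $\omega\cdot 2$, $\omega^2$ are ordinal order types. An enumeration operator $\Gamma$ is a c.e. set of pairs $(\alpha,\varphi)$ with $\alpha$ a finite set of basic (atomic or negated atomic) sentences of the input language with constants from $\omega$ and $\varphi$ a basic sentence of the output language with constants from $\omega$; $\Gamma(X)=\{\varphi : (\alpha,\varphi)\in\Gamma,\ \alpha\subseteq X\}$. $\Gamma$ is a computable embedding of $\mathcal{K}_0$ into $\mathcal{K}_1$ ($\mathcal{K}_0\leq_c\mathcal{K}_1$) if for every $\mathcal{A}\in\mathcal{K}_0$, $\Gamma$ applied to the atomic diagram of $\mathcal{A}$ is the atomic diagram of a structure $\Gamma(\mathcal{A})\in\mathcal{K}_1$, and for all $\mathcal{A},\mathcal{B}\in\mathcal{K}_0$, $\mathcal{A}\cong\mathcal{B}$ iff $\Gamma(\mathcal{A})\cong\Gamma(\mathcal{B})$. -}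

module Defs where

open import Data.Fin.Base using (Fin)
import Data.Fin.Properties as Fin
open import Data.List.Base using (List; []; _∷_)
open import Data.List.Relation.Unary.All using (All)
open import Data.Nat.Base using (ℕ; zero; suc; _+_; _*_; _<_)
import Data.Nat.Properties as ℕ
open import Data.Product.Base using (Σ; ∃; _×_; _,_; proj₁)
open import Data.Product.Relation.Binary.Lex.Strict using (×-strictTotalOrder)
open import Data.Sum.Base using (_⊎_)
open import Data.Vec.Base using (Vec; []; _∷_; lookup)
open import Function.Base using (_on_)
open import Function.Bundles using (_⇔_)
open import Level using (0ℓ)
open import Relation.Binary.Bundles using (StrictTotalOrder)
open import Relation.Binary.Bundles.Raw using (RawRelation)
open import Relation.Binary.Core using (Rel)
import Relation.Binary.Construct.Flip.Ord as Flip
open import Relation.Binary.Morphism.Structures using (IsOrderIsomorphism)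
open import Relation.Binary.PropositionalEquality.Core using (_≡_; _≢_)
open import Relation.Nullary.Negation.Core using (¬_)
open import Relation.Unary using (Pred)

------------------------------------------------------------------------
-- Partial computable functions (Kleene's μ-recursive functions)

data Rec : ℕ → Set where
  zeroᶠ : ∀ {n} → Rec n
  sucᶠ  : Rec 1
  projᶠ : ∀ {n} → Fin n → Rec n
  compᶠ : ∀ {m n} → Rec m → Vec (Rec n) m → Rec n
  precᶠ : ∀ {n} → Rec n → Rec (2 + n) → Rec (1 + n)
  minᶠ  : ∀ {n} → Rec (1 + n) → Rec n

infix 4 _[_]⇓_ _[_]⇓*_

mutual

  data _[_]⇓_ : ∀ {n} → Rec n → Vec ℕ n → ℕ → Set where
    ⇓zero : ∀ {n} {xs : Vec ℕ n} → zeroᶠ [ xs ]⇓ 0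
    ⇓suc  : ∀ {x} → sucᶠ [ x ∷ [] ]⇓ suc x
    ⇓proj : ∀ {n} {i : Fin n} {xs} → projᶠ i [ xs ]⇓ lookup xs i
    ⇓comp : ∀ {m n} {f : Rec m} {gs : Vec (Rec n) m} {xs ys z} →
            gs [ xs ]⇓* ys → f [ ys ]⇓ z → compᶠ f gs [ xs ]⇓ z
    ⇓prec-zero : ∀ {n} {f : Rec n} {g xs z} →
                 f [ xs ]⇓ z → precᶠ f g [ 0 ∷ xs ]⇓ z
    ⇓prec-suc  : ∀ {n} {f : Rec n} {g k xs y z} →
                 precᶠ f g [ k ∷ xs ]⇓ y → g [ k ∷ y ∷ xs ]⇓ z →
                 precᶠ f g [ suc k ∷ xs ]⇓ z
    ⇓min : ∀ {n} {f : Rec (1 + n)} {xs k} →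
           (∀ {i} → i < k → ∃ λ y → f [ i ∷ xs ]⇓ suc y) →
           f [ k ∷ xs ]⇓ 0 → minᶠ f [ xs ]⇓ k

  data _[_]⇓*_ {n} : ∀ {m} → Vec (Rec n) m → Vec ℕ n → Vec ℕ m → Set where
    []  : ∀ {xs} → [] [ xs ]⇓* []
    _∷_ : ∀ {m} {g} {gs : Vec (Rec n) m} {xs y ys} →
          g [ xs ]⇓ y → gs [ xs ]⇓* ys → g ∷ gs [ xs ]⇓* y ∷ ys

-- Relative to a coding of A in ℕ, a subset of A is c.e. when it is listed by
-- a partial computable function.

CE : {A : Set} → (A → ℕ) → Pred A 0ℓ → Set
CE code S = ∃ λ (f : Rec 1) → ∀ a → S a ⇔ ∃ λ x → f [ x ∷ [] ]⇓ code a

------------------------------------------------------------------------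
-- Basic sentences in the language {<} with constants from ω, and their
-- numerical codes

infix 7 _<ˢ_ _≮ˢ_ _≡ˢ_ _≢ˢ_

data Basic : Set where
  _<ˢ_ _≮ˢ_ _≡ˢ_ _≢ˢ_ : ℕ → ℕ → Basic

triangular : ℕ → ℕ
triangular zero    = 0
triangular (suc n) = suc n + triangular n

-- Cantor's bijection ℕ × ℕ → ℕ
pair : ℕ → ℕ → ℕ
pair x y = triangular (x + y) + y

codeBasic : Basic → ℕ
codeBasic (m <ˢ n) = 0 + 4 * pair m n
codeBasic (m ≮ˢ n) = 1 + 4 * pair m n
codeBasic (m ≡ˢ n) = 2 + 4 * pair m n
codeBasic (m ≢ˢ n) = 3 + 4 * pair m n

codeList : List Basic → ℕ
codeList []      = 0
codeList (φ ∷ α) = suc (pair (codeBasic φ) (codeList α))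

codeAxiom : List Basic × Basic → ℕ
codeAxiom (α , φ) = pair (codeList α) (codeBasic φ)

------------------------------------------------------------------------
-- Enumeration operators

-- The finite set α of a pair (α , φ) is given by a list of its members.

record EnumerationOperator : Set₁ where
  field
    Axiom : Pred (List Basic × Basic) 0ℓ
    ce    : CE codeAxiom Axiom

  apply : Pred Basic 0ℓ → Pred Basic 0ℓ
  apply X φ = ∃ λ α → Axiom (α , φ) × All X α

------------------------------------------------------------------------
-- Structures with domain contained in ω

-- Only the restriction of _≺_ to Dom is part of the structure.

record Structure : Set₁ where
  infix 4 _≺_
  field
    Dom : Pred ℕ 0ℓ
    _≺_ : Rel ℕ 0ℓ

  -- Elements are compared by their underlying numbers, so membership proofs
  -- in Dom do not matter.
  relation : RawRelation 0ℓ 0ℓ 0ℓ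
  relation = record
    { Carrier = Σ ℕ Dom
    ; _≈_     = _≡_ on proj₁
    ; _∼_     = _≺_ on proj₁
    }

  -- Each number in Dom is named by the constant it is.
  diagram : Pred Basic 0ℓ
  diagram (m <ˢ n) = Dom m × Dom n × m ≺ n
  diagram (m ≮ˢ n) = Dom m × Dom n × ¬ (m ≺ n)
  diagram (m ≡ˢ n) = Dom m × Dom n × m ≡ n
  diagram (m ≢ˢ n) = Dom m × Dom n × m ≢ n

open Structure using (relation; diagram)

infix 4 _≅_

_≅_ : Rel (RawRelation 0ℓ 0ℓ 0ℓ) 0ℓ
R ≅ S = ∃ (IsOrderIsomorphism R._≈_ S._≈_ R._∼_ S._∼_)
  where
  module R = RawRelation R
  module S = RawRelation S

------------------------------------------------------------------------
-- Computable embeddings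

_isImageOf_under_ : Structure → Structure → EnumerationOperator → Set
B isImageOf A under Γ = ∀ φ → EnumerationOperator.apply Γ (diagram A) φ ⇔ diagram B φ

record IsComputableEmbedding (K₀ K₁ : Pred Structure 0ℓ)
                             (Γ : EnumerationOperator) : Set₁ where
  field
    image : ∀ A → K₀ A → ∃ λ B → B isImageOf A under Γ × K₁ B
    iso⇔  : ∀ {A A′ B B′} → K₀ A → K₀ A′ →
            B isImageOf A under Γ → B′ isImageOf A′ under Γ →
            relation A ≅ relation A′ ⇔ relation B ≅ relation B′

infix 4 _≤ᶜ_

_≤ᶜ_ : Pred Structure 0ℓ → Pred Structure 0ℓ → Set₁
K₀ ≤ᶜ K₁ = ∃ (IsComputableEmbedding K₀ K₁)

------------------------------------------------------------------------
-- Linear orders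

LinearOrder : Set₁
LinearOrder = StrictTotalOrder 0ℓ 0ℓ 0ℓ

｛_,_｝ : LinearOrder → LinearOrder → Pred Structure 0ℓ
｛ L , M ｝ A = relation A ≅ L.rawRelation ⊎ relation A ≅ M.rawRelation
  where
  module L = StrictTotalOrder L
  module M = StrictTotalOrder M

𝟚 ω : LinearOrder
𝟚 = Fin.<-strictTotalOrder 2
ω = ℕ.<-strictTotalOrder

infixl 7 _·_
infix  8 _⋆

-- L · M is M-many copies of L, so the M-coordinate is the significant one.
_·_ : LinearOrder → LinearOrder → LinearOrder
L · M = ×-strictTotalOrder M L

_⋆ : LinearOrder → LinearOrder
_⋆ = Flip.strictTotalOrder

ω² : LinearOrder
ω² = ω · ω

{-# OPTIONS --safe #-}
module Submission where

-- Γ sends A to the pairs (a , b) of elements of A such that some w ≺ a and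
-- some z ≻ a exceed b as natural numbers, ordered lexicographically with a
-- significant. Row a is all of A when a has infinitely many elements on both
-- sides, and it is finite otherwise. In ω · 2 the infinite rows are those of the
-- second copy of ω, so the finite rows, which come first, add up to ω and the
-- image is ω + (ω · 2) · ω = ω². The construction commutes with reversal, which
-- gives the case of ω⋆ · 2.

-- An enumeration operator acts on finite pieces of the diagram, so it can never learn which copy an
-- element lies in; membership of (a , b) needs a finite certificate. Infinitude of a side is
-- therefore tested numerically: a set of numbers is infinite exactly when it exceeds every b.
-- Testing both sides makes the condition self-dual, so one operator serves both types without
-- knowing which it was given. In ω · 2 the lower test is the restrictive one: the finitely many
-- numbers below an element of the first copy bound b.
--
-- The final identity rests on 2 · ω = ω and 1 + ω = ω: each infinite row splits into two rows of
-- ω², after the finite rows together have filled one.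
--
-- Excluded middle is used only to enumerate the union of the finite rows in increasing order, where
-- membership is not assumed decidable.

open import Defs
open import Axiom.ExcludedMiddle using (ExcludedMiddle)
open import Level using (0ℓ)
open import Data.Fin.Base using (Fin; zero; suc; toℕ; fromℕ<; opposite)
open import Data.Fin.Patterns
import Data.Fin.Properties as Fin
open import Data.List.Base as List using (List; []; _∷_; _++_)
open import Data.List.Membership.Propositional using (_∈_)
open import Data.List.Relation.Unary.All using (All; []; _∷_)
open import Data.List.Relation.Unary.Any using (here; there)
open import Data.Nat.Base
open import Data.Nat.DivMod
  using (_%_; _/_; [m+kn]%n≡m%n; m<n⇒m%n≡m; m<n⇒m/n≡0; m*n/n≡m; +-distrib-/-∣ʳ)
open import Data.Nat.Divisibility using (n∣m*n)
open import Data.Nat.Properties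
open import Data.Product.Base using (Σ; ∃; ∃₂; _×_; _,_; proj₁; proj₂; map₁)
open import Data.Product.Relation.Binary.Lex.Strict using (×-Lex)
open import Data.Sum.Base as Sum using (_⊎_; inj₁; inj₂)
open import Data.Unit.Base using (⊤; tt)
open import Data.Vec.Base as Vec using (Vec; []; _∷_; lookup)
open import Function.Base using (_∘_; case_of_; id; flip; _on_)
open import Function.Bundles using (_⇔_; mk⇔; Equivalence)
open import Function.Definitions using (Injective; Surjective)
open import Relation.Binary.Bundles using (StrictTotalOrder)
open import Relation.Binary.Bundles.Raw using (RawRelation)
open import Relation.Binary.Core using (Rel)
open import Relation.Binary.Definitions using (Transitive; tri<; tri≈; tri>)
import Relation.Binary.Morphism.Construct.Composition as Composition
import Relation.Binary.Morphism.OrderMonomorphism as OrderMonomorphism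
open import Relation.Binary.Morphism.Structures using (IsOrderMonomorphism; IsOrderIsomorphism)
open import Relation.Binary.PropositionalEquality
open import Relation.Binary.Structures using (IsStrictTotalOrder)
open import Relation.Nullary.Decidable.Core using (yes; no)
open import Relation.Nullary.Negation.Core using (¬_; contradiction)
open import Relation.Unary using (Pred)

open Structure using (Dom; relation; diagram)
open StrictTotalOrder using (rawRelation)
open EnumerationOperator using (apply)

-- Inverting the pairing function

triangular-mono : ∀ {m n} → m ≤ n → triangular m ≤ triangular n
triangular-mono z≤n       = z≤n
triangular-mono (s≤s m≤n) = s≤s (+-mono-≤ m≤n (triangular-mono m≤n))

pair-mono : ∀ {x x′ y y′} → x ≤ x′ → y ≤ y′ → pair x y ≤ pair x′ y′
pair-mono x≤x′ y≤y′ = +-mono-≤ (triangular-mono (+-mono-≤ x≤x′ y≤y′)) y≤y′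

-- The largest r with `triangular r ≤ n`, as a primitive recursion: the increment is 1 exactly when
-- `suc n` has reached the next triangular number.
root : ℕ → ℕ
root zero    = 0
root (suc n) = root n + (1 ∸ (triangular (suc (root n)) ∸ suc n))

root-bounds : ∀ n → triangular (root n) ≤ n × n < triangular (suc (root n))
root-bounds zero = z≤n , s≤s z≤n
root-bounds (suc n) with root-bounds n | triangular (suc (root n)) ≤? suc n
... | _ , upper | yes low
  rewrite m≤n⇒m∸n≡0 low | +-comm (root n) 1 =
    low , s≤s (≤-trans upper (m≤n+m _ (suc (root n))))
... | lower , _ | no ¬low
  rewrite m≤n⇒m∸n≡0 (m<n⇒0<n∸m (≰⇒> ¬low)) | +-identityʳ (root n) =
    m≤n⇒m≤1+n lower , ≰⇒> ¬low

triangular-squeeze : ∀ {r s n} → triangular r ≤ n → n < triangular (suc s) → r ≤ s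
triangular-squeeze lower upper =
  ≮⇒≥ λ s<r → <⇒≱ upper (≤-trans (triangular-mono s<r) lower)

-- The summand y is at most x + y, so `pair x y` stays below the triangular number of x + y + 1.
root-pair : ∀ x y → root (pair x y) ≡ x + y
root-pair x y = ≤-antisym
  (triangular-squeeze (proj₁ (root-bounds (pair x y))) (s≤s upper))
  (triangular-squeeze (m≤m+n _ y) (proj₂ (root-bounds (pair x y))))
  where
  upper : pair x y ≤ (x + y) + triangular (x + y)
  upper = ≤-trans (+-monoʳ-≤ _ (m≤n+m y x)) (≤-reflexive (+-comm (triangular (x + y)) _))

π₁ π₂ : ℕ → ℕ
π₂ n = n ∸ triangular (root n)
π₁ n = root n ∸ π₂ n

π₂-pair : ∀ x y → π₂ (pair x y) ≡ y
π₂-pair x y rewrite root-pair x y = m+n∸m≡n (triangular (x + y)) y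

π₁-pair : ∀ x y → π₁ (pair x y) ≡ x
π₁-pair x y rewrite π₂-pair x y | root-pair x y = m+n∸n≡m x y

pair-π : ∀ n → pair (π₁ n) (π₂ n) ≡ n
pair-π n = trans (cong (λ r → triangular r + π₂ n) (m∸n+n≡m π₂≤root))
                 (m+[n∸m]≡n (proj₁ (root-bounds n)))
  where
  π₂≤root : π₂ n ≤ root n
  π₂≤root = m≤n+o⇒m∸n≤o _ (triangular (root n))
    (≤-trans (s≤s⁻¹ (proj₂ (root-bounds n))) (≤-reflexive (+-comm (root n) _)))

pair-injective : ∀ {x y x′ y′} → pair x y ≡ pair x′ y′ → x ≡ x′ × y ≡ y′
pair-injective {x} {y} {x′} {y′} eq =
  trans (sym (π₁-pair x y)) (trans (cong π₁ eq) (π₁-pair x′ y′)) ,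
  trans (sym (π₂-pair x y)) (trans (cong π₂ eq) (π₂-pair x′ y′))

basic : ℕ → ℕ → Basic
basic 0 p = π₁ p <ˢ π₂ p
basic 1 p = π₁ p ≮ˢ π₂ p
basic 2 p = π₁ p ≡ˢ π₂ p
-- Decoding passes remainders modulo 4, so the catch-all stands for 3.
basic _ p = π₁ p ≢ˢ π₂ p

decodeBasic : ℕ → Basic
decodeBasic c = basic (c % 4) (c / 4)

basic-%-/ : ∀ {i} p → i < 4 → basic ((i + 4 * p) % 4) ((i + 4 * p) / 4) ≡ basic i p
basic-%-/ {i} p i<4 = cong₂ basic
  (trans (cong (λ q → (i + q) % 4) (*-comm 4 p)) (trans ([m+kn]%n≡m%n i p 4) (m<n⇒m%n≡m i<4)))
  (trans (cong (λ q → (i + q) / 4) (*-comm 4 p)) (trans (+-distrib-/-∣ʳ i (n∣m*n p))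
    (cong₂ _+_ (m<n⇒m/n≡0 i<4) (m*n/n≡m p 4))))

decode-codeBasic : ∀ φ → decodeBasic (codeBasic φ) ≡ φ
decode-codeBasic (m <ˢ n) =
  trans (basic-%-/ {0} (pair m n) (s≤s z≤n))
        (cong₂ _<ˢ_ (π₁-pair m n) (π₂-pair m n))
decode-codeBasic (m ≮ˢ n) =
  trans (basic-%-/ {1} (pair m n) (s≤s (s≤s z≤n)))
        (cong₂ _≮ˢ_ (π₁-pair m n) (π₂-pair m n))
decode-codeBasic (m ≡ˢ n) =
  trans (basic-%-/ {2} (pair m n) (s≤s (s≤s (s≤s z≤n))))
        (cong₂ _≡ˢ_ (π₁-pair m n) (π₂-pair m n))
decode-codeBasic (m ≢ˢ n) =
  trans (basic-%-/ {3} (pair m n) (s≤s (s≤s (s≤s (s≤s z≤n)))))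
        (cong₂ _≢ˢ_ (π₁-pair m n) (π₂-pair m n))

codeBasic-injective : ∀ {φ ψ} → codeBasic φ ≡ codeBasic ψ → φ ≡ ψ
codeBasic-injective {φ} {ψ} eq =
  trans (sym (decode-codeBasic φ)) (trans (cong decodeBasic eq) (decode-codeBasic ψ))

codeList-injective : ∀ {α β} → codeList α ≡ codeList β → α ≡ β
codeList-injective {[]}    {[]}    _  = refl
codeList-injective {φ ∷ α} {ψ ∷ β} eq with pair-injective (suc-injective eq)
... | eqφ , eqα = cong₂ _∷_ (codeBasic-injective eqφ) (codeList-injective eqα)

codeAxiom-injective : ∀ {a b} → codeAxiom a ≡ codeAxiom b → a ≡ b
codeAxiom-injective eq with pair-injective eq
... | eqα , eqφ = cong₂ _,_ (codeList-injective eqα) (codeBasic-injective eqφ)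

-- Total computable functions

mutual

  -- Ensures that an enumerated code determines the axiom listed. For minimisation, the smaller of
  -- two distinct results would be an argument with both value 0 and a successor value.
  ⇓-deterministic : ∀ {n} {f : Rec n} {xs y z} → f [ xs ]⇓ y → f [ xs ]⇓ z → y ≡ z
  ⇓-deterministic ⇓zero ⇓zero = refl
  ⇓-deterministic ⇓suc  ⇓suc  = refl
  ⇓-deterministic ⇓proj ⇓proj = refl
  ⇓-deterministic (⇓comp ps p) (⇓comp qs q) with ⇓*-deterministic ps qs
  ... | refl = ⇓-deterministic p q
  ⇓-deterministic (⇓prec-zero p) (⇓prec-zero q) = ⇓-deterministic p q
  ⇓-deterministic (⇓prec-suc p p′) (⇓prec-suc q q′) with ⇓-deterministic p q
  ... | refl = ⇓-deterministic p′ q′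
  ⇓-deterministic (⇓min {k = k} ps p) (⇓min {k = l} qs q) with <-cmp k l
  ... | tri≈ _ k≡l _ = k≡l
  ... | tri< k<l _ _ with () ← ⇓-deterministic p (proj₂ (qs k<l))
  ... | tri> _ _ l<k with () ← ⇓-deterministic (proj₂ (ps l<k)) q

  ⇓*-deterministic : ∀ {m n} {fs : Vec (Rec n) m} {xs ys zs} →
                     fs [ xs ]⇓* ys → fs [ xs ]⇓* zs → ys ≡ zs
  ⇓*-deterministic []       []       = refl
  ⇓*-deterministic (p ∷ ps) (q ∷ qs) = cong₂ _∷_ (⇓-deterministic p q) (⇓*-deterministic ps qs)

Computable : ∀ {n} → (Vec ℕ n → ℕ) → Set
Computable f = ∃ λ r → ∀ ρ → r [ ρ ]⇓ f ρ

Computable₁ : (ℕ → ℕ) → Set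
Computable₁ f = ∃ λ r → ∀ x → r [ x ∷ [] ]⇓ f x

Computable₂ : (ℕ → ℕ → ℕ) → Set
Computable₂ f = ∃ λ r → ∀ x y → r [ x ∷ y ∷ [] ]⇓ f x y

module _ {n : ℕ} where

  zeroᶜ : Computable {n} (λ _ → 0)
  zeroᶜ = zeroᶠ , λ _ → ⇓zero

  projᶜ : ∀ i → Computable {n} (λ ρ → lookup ρ i)
  projᶜ i = projᶠ i , λ _ → ⇓proj

  comp₁ : ∀ {f g} → Computable₁ f → Computable {n} g → Computable (λ ρ → f (g ρ))
  comp₁ (r , r⇓) (s , s⇓) = compᶠ r (s ∷ []) , λ ρ → ⇓comp (s⇓ ρ ∷ []) (r⇓ _)

  comp₂ : ∀ {f g h} → Computable₂ f → Computable {n} g → Computable h →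
          Computable (λ ρ → f (g ρ) (h ρ))
  comp₂ (r , r⇓) (s , s⇓) (t , t⇓) =
    compᶠ r (s ∷ t ∷ []) , λ ρ → ⇓comp (s⇓ ρ ∷ t⇓ ρ ∷ []) (r⇓ _ _)

  -- With the recursion equations as hypotheses, a function keeps its own Agda definition; in most
  -- uses below they hold by `refl`.
  precᶜ : ∀ {f b s} → (∀ ρ → f (0 ∷ ρ) ≡ b ρ) →
          (∀ k ρ → f (suc k ∷ ρ) ≡ s (k ∷ f (k ∷ ρ) ∷ ρ)) →
          Computable {n} b → Computable s → Computable f
  precᶜ {f} base step (b , b⇓) (s , s⇓) = precᶠ b s , λ { (k ∷ ρ) → evaluates k ρ }
    where
    evaluates : ∀ k ρ → precᶠ b s [ k ∷ ρ ]⇓ f (k ∷ ρ)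
    evaluates zero    ρ = subst (precᶠ b s [ 0 ∷ ρ ]⇓_) (sym (base ρ)) (⇓prec-zero (b⇓ ρ))
    evaluates (suc k) ρ = subst (precᶠ b s [ suc k ∷ ρ ]⇓_) (sym (step k ρ))
                                (⇓prec-suc (evaluates k ρ) (s⇓ _))

unary : ∀ {f} → Computable {1} (λ ρ → f (lookup ρ zero)) → Computable₁ f
unary (r , r⇓) = r , λ x → r⇓ (x ∷ [])

binary : ∀ {f} → Computable {2} (λ ρ → f (lookup ρ zero) (lookup ρ (suc zero))) → Computable₂ f
binary (r , r⇓) = r , λ x y → r⇓ (x ∷ y ∷ [])

sucᶜ : Computable₁ suc
sucᶜ = sucᶠ , λ _ → ⇓suc

constᶜ : ∀ {n} k → Computable {n} (λ _ → k)
constᶜ zero    = zeroᶜ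
constᶜ (suc k) = comp₁ sucᶜ (constᶜ k)

+ᶜ : Computable₂ _+_
+ᶜ = binary (precᶜ (λ _ → refl) (λ _ _ → refl)
      (projᶜ zero) (comp₁ sucᶜ (projᶜ (suc zero))))

*ᶜ : Computable₂ _*_
*ᶜ = binary (precᶜ (λ _ → refl) (λ _ _ → refl)
      zeroᶜ (comp₂ +ᶜ (projᶜ (suc (suc zero))) (projᶜ (suc zero))))

predᶜ : Computable₁ pred
predᶜ = unary (precᶜ (λ _ → refl) (λ _ _ → refl) zeroᶜ (projᶜ zero))

∸ᶜ : Computable₂ _∸_
∸ᶜ = binary (comp₂ flipped (projᶜ (suc zero)) (projᶜ zero))
  where
  flipped : Computable₂ (λ y x → x ∸ y)
  flipped = binary (precᶜ (λ _ → refl) (λ k ρ → sym (pred[m∸n]≡m∸[1+n] (lookup ρ zero) k))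
              (projᶜ zero) (comp₁ predᶜ (projᶜ (suc zero))))

triangularᶜ : Computable₁ triangular
triangularᶜ = unary (precᶜ (λ _ → refl) (λ _ _ → refl)
                zeroᶜ (comp₂ +ᶜ (comp₁ sucᶜ (projᶜ zero)) (projᶜ (suc zero))))

pairᶜ : Computable₂ pair
pairᶜ = binary (comp₂ +ᶜ (comp₁ triangularᶜ (comp₂ +ᶜ (projᶜ zero) (projᶜ (suc zero))))
                         (projᶜ (suc zero)))

rootᶜ : Computable₁ root
rootᶜ = unary (precᶜ (λ _ → refl) (λ _ _ → refl) zeroᶜ
          (comp₂ +ᶜ (projᶜ (suc zero))
            (comp₂ ∸ᶜ (constᶜ 1)
              (comp₂ ∸ᶜ (comp₁ triangularᶜ (comp₁ sucᶜ (projᶜ (suc zero))))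
                        (comp₁ sucᶜ (projᶜ zero))))))

π₂ᶜ : Computable₁ π₂
π₂ᶜ = unary (comp₂ ∸ᶜ (projᶜ zero) (comp₁ triangularᶜ (comp₁ rootᶜ (projᶜ zero))))

π₁ᶜ : Computable₁ π₁
π₁ᶜ = unary (comp₂ ∸ᶜ (comp₁ rootᶜ (projᶜ zero)) (comp₁ π₂ᶜ (projᶜ zero)))

decodeVec : ∀ n → ℕ → Vec ℕ n
decodeVec zero    _ = []
decodeVec (suc n) x = π₁ x ∷ decodeVec n (π₂ x)

encodeVec : ∀ {n} → Vec ℕ n → ℕ
encodeVec []      = 0
encodeVec (x ∷ ρ) = pair x (encodeVec ρ)

decode-encodeVec : ∀ {n} (ρ : Vec ℕ n) → decodeVec n (encodeVec ρ) ≡ ρ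
decode-encodeVec []      = refl
decode-encodeVec (x ∷ ρ) = cong₂ _∷_ (π₁-pair x _)
  (trans (cong (decodeVec _) (π₂-pair x _)) (decode-encodeVec ρ))

decodeVecᶜ : ∀ n {f} → Computable₁ f →
             ∃ λ (rs : Vec (Rec 1) n) → ∀ x → rs [ x ∷ [] ]⇓* decodeVec n (f x)
decodeVecᶜ zero    _ = [] , λ _ → []
decodeVecᶜ (suc n) {f} (s , s⇓) =
  let f̂ : Computable {1} (λ ρ → f (lookup ρ zero))
      f̂ = s , λ { (x ∷ []) → s⇓ x }
      r  , r⇓  = unary {π₁ ∘ f} (comp₁ π₁ᶜ f̂)
      rs , rs⇓ = decodeVecᶜ n (unary {π₂ ∘ f} (comp₁ π₂ᶜ f̂))
  in r ∷ rs , λ x → r⇓ x ∷ rs⇓ x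

-- Enumerations take one argument, so tuples are packed by iterated pairing. Unpacking is onto, so
-- nothing of the range is lost; determinism and injective codes ensure that nothing is added.
computable-range⇒CE : ∀ {A : Set} {n} (code : A → ℕ) → (∀ {a b} → code a ≡ code b → a ≡ b) →
                      (F : Vec ℕ n → A) → Computable (code ∘ F) →
                      CE code (λ a → ∃ λ ρ → a ≡ F ρ)
computable-range⇒CE {n = n} code code-injective F (r , r⇓) =
  let rs , rs⇓ = decodeVecᶜ n (unary (projᶜ zero))
      f⇓ : ∀ x → compᶠ r rs [ x ∷ [] ]⇓ code (F (decodeVec n x))
      f⇓ x = ⇓comp (rs⇓ x) (r⇓ _)
  in compᶠ r rs , λ a → mk⇔
    (λ { (ρ , refl) → encodeVec ρ ,
         subst (λ σ → compᶠ r rs [ encodeVec ρ ∷ [] ]⇓ code (F σ)) (decode-encodeVec ρ)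
               (f⇓ (encodeVec ρ)) })
    (λ { (x , ⇓a) → decodeVec n x , code-injective (⇓-deterministic ⇓a (f⇓ x)) })

-- Axiom schemes

infix 9 #_
infix 8 1+_⊕_
infix 7 _<ᵗ_ _≮ᵗ_ _≡ᵗ_ _≢ᵗ_

⇓*-tabulate : ∀ {m n} {fs : Fin n → Rec m} {xs} (ρ : Vec ℕ n) →
              (∀ i → fs i [ xs ]⇓ lookup ρ i) → Vec.tabulate fs [ xs ]⇓* ρ
⇓*-tabulate []      fs⇓ = []
⇓*-tabulate (x ∷ ρ) fs⇓ = fs⇓ zero ∷ ⇓*-tabulate ρ (fs⇓ ∘ suc)

-- Axioms are given by syntax so that computability of their codes is proved once, by recursion. As
-- u varies, `1+ t ⊕ u` runs through all numbers above t; `⟨ t , u ⟩` names an element of the image.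
data Term (n : ℕ) : Set where
  #_         : Fin n → Term n
  1+_⊕_ ⟨_,_⟩ : Term n → Term n → Term n

data Literal (n : ℕ) : Set where
  _<ᵗ_ _≮ᵗ_ _≡ᵗ_ _≢ᵗ_ : Term n → Term n → Literal n

Scheme : ℕ → Set
Scheme n = List (Literal n) × Literal n

module _ {n : ℕ} where

  value : Vec ℕ n → Term n → ℕ
  value ρ (# i)     = lookup ρ i
  value ρ (1+ t ⊕ u) = suc (value ρ t + value ρ u)
  value ρ ⟨ t , u ⟩ = pair (value ρ t) (value ρ u)

  ground : Vec ℕ n → Literal n → Basic
  ground ρ (t <ᵗ u) = value ρ t <ˢ value ρ u
  ground ρ (t ≮ᵗ u) = value ρ t ≮ˢ value ρ u
  ground ρ (t ≡ᵗ u) = value ρ t ≡ˢ value ρ u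
  ground ρ (t ≢ᵗ u) = value ρ t ≢ˢ value ρ u

  instantiate : Scheme n → Vec ℕ n → List Basic × Basic
  instantiate (ls , l) ρ = List.map (ground ρ) ls , ground ρ l

  -- The index selecting a scheme is the first parameter; indices out of range
  -- select the last scheme.
  select : Scheme n → List (Scheme n) → Vec ℕ (suc n) → List Basic × Basic
  select s []        (_     ∷ ρ) = instantiate s ρ
  select s (_ ∷ _)   (zero  ∷ ρ) = instantiate s ρ
  select s (s′ ∷ ss) (suc i ∷ ρ) = select s′ ss (i ∷ ρ)

  Instance : Scheme n → List (Scheme n) → Pred (List Basic × Basic) 0ℓ
  Instance s ss a = ∃ λ ρ → a ≡ select s ss ρ

  valueᶜ : ∀ t → Computable (λ ρ → value ρ t)
  valueᶜ (# i)     = projᶜ i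
  valueᶜ (1+ t ⊕ u) = comp₁ sucᶜ (comp₂ +ᶜ (valueᶜ t) (valueᶜ u))
  valueᶜ ⟨ t , u ⟩ = comp₂ pairᶜ (valueᶜ t) (valueᶜ u)

  codeᶜ : ∀ k t u → Computable (λ ρ → k + 4 * pair (value ρ t) (value ρ u))
  codeᶜ k t u = comp₂ +ᶜ (constᶜ k) (comp₂ *ᶜ (constᶜ 4) (comp₂ pairᶜ (valueᶜ t) (valueᶜ u)))

  codeBasicᶜ : ∀ l → Computable (λ ρ → codeBasic (ground ρ l))
  codeBasicᶜ (t <ᵗ u) = codeᶜ 0 t u
  codeBasicᶜ (t ≮ᵗ u) = codeᶜ 1 t u
  codeBasicᶜ (t ≡ᵗ u) = codeᶜ 2 t u
  codeBasicᶜ (t ≢ᵗ u) = codeᶜ 3 t u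

  codeListᶜ : ∀ ls → Computable (λ ρ → codeList (List.map (ground ρ) ls))
  codeListᶜ []       = zeroᶜ
  codeListᶜ (l ∷ ls) = comp₁ sucᶜ (comp₂ pairᶜ (codeBasicᶜ l) (codeListᶜ ls))

  instantiateᶜ : ∀ s → Computable (λ ρ → codeAxiom (instantiate s ρ))
  instantiateᶜ (ls , l) = comp₂ pairᶜ (codeListᶜ ls) (codeBasicᶜ l)

  -- Primitive recursion serves as case distinction on the index: with one scheme left the step
  -- repeats the previous value, otherwise it discards that value and continues from the predecessor
  -- index.
  selectᶜ : ∀ s ss → Computable (λ ρ → codeAxiom (select s ss ρ))
  selectᶜ s [] = precᶜ (λ _ → refl) (λ _ _ → refl) (instantiateᶜ s) (projᶜ (suc zero))
  selectᶜ s (s′ ∷ ss) with selectᶜ s′ ss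
  ... | r , r⇓ = precᶜ {b = λ ρ → codeAxiom (instantiate s ρ)}
                       {s = λ { (i ∷ _ ∷ ρ) → codeAxiom (select s′ ss (i ∷ ρ)) }}
                       (λ _ → refl) (λ _ _ → refl) (instantiateᶜ s)
                       (compᶠ r (projᶠ zero ∷ Vec.tabulate (λ k → projᶠ (suc (suc k)))) ,
                        λ { (i ∷ y ∷ ρ) → 
                          ⇓comp (⇓proj ∷ ⇓*-tabulate ρ (λ k → ⇓proj {i = suc (suc k)}))
                                (r⇓ (i ∷ ρ)) })

operator : ∀ {n} → Scheme n → List (Scheme n) → EnumerationOperator
operator s ss = record
  { Axiom = Instance s ss
  ; ce    = computable-range⇒CE codeAxiom codeAxiom-injective (select s ss) (selectᶜ s ss)
  }

∈⇒Instance : ∀ {n} {s t : Scheme n} {ss} → t ∈ s ∷ ss → ∀ ρ → Instance s ss (instantiate t ρ)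
∈⇒Instance {ss = []}    (here refl) ρ = 0 ∷ ρ , refl
∈⇒Instance {ss = _ ∷ _} (here refl) ρ = 0 ∷ ρ , refl
∈⇒Instance {ss = s′ ∷ ss} (there t∈) ρ with ∈⇒Instance t∈ ρ
... | i ∷ σ , eq = suc i ∷ σ , eq

Instance⇒∈ : ∀ {n} {s : Scheme n} ss {a} → Instance s ss a →
             ∃ λ t → t ∈ s ∷ ss × ∃ λ ρ → a ≡ instantiate t ρ
Instance⇒∈ []        (_     ∷ ρ , eq) = _ , here refl , ρ , eq
Instance⇒∈ (_ ∷ _)   (zero  ∷ ρ , eq) = _ , here refl , ρ , eq
Instance⇒∈ (s′ ∷ ss) (suc i ∷ ρ , eq) with Instance⇒∈ ss (i ∷ ρ , eq)
... | t , t∈ , σ = t , there t∈ , σ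

-- Isomorphisms of linear orders

IsLinear : RawRelation 0ℓ 0ℓ 0ℓ → Set
IsLinear R = IsStrictTotalOrder (RawRelation._≈_ R) (RawRelation._∼_ R)

isLinear : (L : LinearOrder) → IsLinear (rawRelation L)
isLinear = StrictTotalOrder.isStrictTotalOrder

≅-linear : ∀ {R S} → R ≅ S → IsLinear S → IsLinear R
≅-linear (_ , iso) =
  OrderMonomorphism.isStrictTotalOrder (IsOrderIsomorphism.isOrderMonomorphism iso)

≅-trans : ∀ {R S T} → IsLinear T → R ≅ S → S ≅ T → R ≅ T
≅-trans T-linear (_ , iso₁) (_ , iso₂) =
  _ , Composition.isOrderIsomorphism (IsStrictTotalOrder.Eq.trans T-linear) iso₁ iso₂

≅-sym : ∀ {R S} → IsLinear S → R ≅ S → S ≅ R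
≅-sym {R} {S} S-linear R≅S@(f , iso) = g , record
  { isOrderMonomorphism = record
    { isOrderHomomorphism = record
      { cong = λ y≈y′ → F.injective (S.Eq.trans (fg _) (S.Eq.trans y≈y′ (S.Eq.sym (fg _))))
      ; mono = λ y<y′ → F.cancel (S.<-respʳ-≈ (S.Eq.sym (fg _)) (S.<-respˡ-≈ (S.Eq.sym (fg _)) y<y′))
      }
    ; injective = λ gy≈gy′ → S.Eq.trans (S.Eq.sym (fg _)) (S.Eq.trans (F.cong gy≈gy′) (fg _))
    ; cancel    = λ gy<gy′ → S.<-respʳ-≈ (fg _) (S.<-respˡ-≈ (fg _) (F.mono gy<gy′))
    }
  ; surjective = λ x → f x , λ z≈fx → F.injective (S.Eq.trans (fg _) z≈fx)
  }
  where
  module F = IsOrderIsomorphism iso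
  module R = IsStrictTotalOrder (≅-linear R≅S S-linear)
  module S = IsStrictTotalOrder S-linear
  g : RawRelation.Carrier S → RawRelation.Carrier R
  g y = proj₁ (F.surjective y)
  fg : ∀ y → RawRelation._≈_ S (f (g y)) y
  fg y = proj₂ (F.surjective y) R.Eq.refl

-- Trichotomy in R does the rest: any other comparison of x and y has an image contradicting
-- irreflexivity or asymmetry in S.
monotone-surjection⇒≅ : ∀ {R S} → IsLinear R → IsLinear S →
  let open RawRelation in
  (f : Carrier R → Carrier S) →
  (∀ {x y} → _≈_ R x y → _≈_ S (f x) (f y)) →
  (∀ {x y} → _∼_ R x y → _∼_ S (f x) (f y)) →
  Surjective (_≈_ R) (_≈_ S) f → R ≅ S
monotone-surjection⇒≅ {R} {S} R-linear S-linear f cong mono surjective = f , record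
  { isOrderMonomorphism = record
    { isOrderHomomorphism = record { cong = cong ; mono = mono }
    ; injective = injective
    ; cancel    = cancel
    }
  ; surjective = surjective
  }
  where
  open RawRelation
  module R = IsStrictTotalOrder R-linear
  module S = IsStrictTotalOrder S-linear
  injective : Injective (_≈_ R) (_≈_ S) f
  injective {x} {y} fx≈fy with R.compare x y
  ... | tri< x<y _ _ = contradiction (mono x<y) (S.irrefl fx≈fy)
  ... | tri≈ _ x≈y _ = x≈y
  ... | tri> _ _ y<x = contradiction (mono y<x) (S.irrefl (S.Eq.sym fx≈fy))
  cancel : Injective (_∼_ R) (_∼_ S) f
  cancel {x} {y} fx<fy with R.compare x y
  ... | tri< x<y _ _ = x<y
  ... | tri≈ _ x≈y _ = contradiction fx<fy (S.irrefl (cong x≈y))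
  ... | tri> _ _ y<x = contradiction fx<fy (S.asym (mono y<x))

domain-≅ : ∀ A B → (∀ n → Dom A n ⇔ Dom B n) →
           (∀ {m n} → Dom A m → Dom A n → Structure._≺_ A m n ⇔ Structure._≺_ B m n) →
           relation A ≅ relation B
domain-≅ A B dom ≺⇔ = (λ (n , n∈) → n , dom.to n∈) , record
  { isOrderMonomorphism = record
    { isOrderHomomorphism = record
      { cong = id
      ; mono = λ {(_ , m∈)} {(_ , n∈)} → Equivalence.to (≺⇔ m∈ n∈)
      }
    ; injective = id
    ; cancel    = λ {(_ , m∈)} {(_ , n∈)} → Equivalence.from (≺⇔ m∈ n∈)
    }
  ; surjective = λ (n , n∈) → (n , dom.from n∈) , id
  }
  where module dom {n} = Equivalence (dom n)

diagram-≅ : ∀ A B → (∀ φ → diagram A φ ⇔ diagram B φ) → relation A ≅ relation B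
diagram-≅ A B same = domain-≅ A B
  (λ n → mk⇔ (λ n∈ → proj₁ (to (n ≡ˢ n) (n∈ , n∈ , refl)))
             (λ n∈ → proj₁ (from (n ≡ˢ n) (n∈ , n∈ , refl))))
  (λ {m} {n} m∈ n∈ → mk⇔
    (λ m≺n → proj₂ (proj₂ (to (m <ˢ n) (m∈ , n∈ , m≺n))))
    (λ m≺n → proj₂ (proj₂ (from (m <ˢ n)
      (proj₁ (to (m ≡ˢ m) (m∈ , m∈ , refl)) , proj₁ (to (n ≡ˢ n) (n∈ , n∈ , refl)) , m≺n)))))
  where
  to   = λ φ → Equivalence.to (same φ)
  from = λ φ → Equivalence.from (same φ)

-- Pulling back an element below `f x` gives an element below x. This invariant separates both pairs
-- of order types.
least≇no-least : ∀ {R S} → IsLinear S →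
  let open RawRelation in
  (∃ λ x → ∀ y → ¬ (_∼_ R y x)) → (∀ x → ∃ λ y → _∼_ S y x) → ¬ (R ≅ S)
least≇no-least {R} S-linear (x , least) no-least R≅S@(f , iso)
  with y , y<fx ← no-least (f x) =
  least (proj₁ (F.surjective y)) (F.cancel (S.<-respˡ-≈ (S.Eq.sym fg) y<fx))
  where
  module F = IsOrderIsomorphism iso
  module S = IsStrictTotalOrder S-linear
  fg = λ {y} → proj₂ (F.surjective y) (IsStrictTotalOrder.Eq.refl (≅-linear R≅S S-linear))

-- The operator

-- The conditions w ≺ a ≺ z with w, z > b are stated with w = 1 + b + p and
-- z = 1 + b + q, so that the parameters p and q range freely.
below-and-above : ∀ {n} → (a b p q : Fin n) → List (Literal n)
below-and-above a b p q =
  (1+ # b ⊕ # p) <ᵗ # a ∷ # a <ᵗ (1+ # b ⊕ # q) ∷ # b ≡ᵗ # b ∷ []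

-- Parameters 0 to 3 are (a , b) with its witnesses, 4 to 7 are (c , d) with its own. The literal
-- `# b ≡ᵗ # b` says that b is in the domain, which the two order literals do not guarantee.
two-rows : List (Literal 8) → List (Literal 8)
two-rows ls = below-and-above 0F 1F 2F 3F ++ below-and-above 4F 5F 6F 7F ++ ls

scheme : List (Literal 8) → Literal 8 → Scheme 8
scheme ls l = two-rows ls , l

𝐚 𝐛 𝐜 𝐝 : Term 8
𝐚 = # 0F
𝐛 = # 1F
𝐜 = # 4F
𝐝 = # 5F

-- Apart from equality, each kind of output literal is split by whether the first coordinates decide
-- it. `≮-fst` asks for `𝐜 <ᵗ 𝐚`, since `𝐚 ≮ᵗ 𝐜` would also admit equal first coordinates.
<-fst ≮-fst ≢-fst <-snd ≮-snd ≢-snd ≡-both : Scheme 8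
<-fst  = scheme (𝐚 <ᵗ 𝐜 ∷ [])          (⟨ 𝐚 , 𝐛 ⟩ <ᵗ ⟨ 𝐜 , 𝐝 ⟩)
≮-fst  = scheme (𝐜 <ᵗ 𝐚 ∷ [])          (⟨ 𝐚 , 𝐛 ⟩ ≮ᵗ ⟨ 𝐜 , 𝐝 ⟩)
≢-fst  = scheme (𝐚 ≢ᵗ 𝐜 ∷ [])          (⟨ 𝐚 , 𝐛 ⟩ ≢ᵗ ⟨ 𝐜 , 𝐝 ⟩)
<-snd  = scheme (𝐚 ≡ᵗ 𝐜 ∷ 𝐛 <ᵗ 𝐝 ∷ []) (⟨ 𝐚 , 𝐛 ⟩ <ᵗ ⟨ 𝐜 , 𝐝 ⟩)
≮-snd  = scheme (𝐚 ≡ᵗ 𝐜 ∷ 𝐛 ≮ᵗ 𝐝 ∷ []) (⟨ 𝐚 , 𝐛 ⟩ ≮ᵗ ⟨ 𝐜 , 𝐝 ⟩)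
≢-snd  = scheme (𝐛 ≢ᵗ 𝐝 ∷ [])          (⟨ 𝐚 , 𝐛 ⟩ ≢ᵗ ⟨ 𝐜 , 𝐝 ⟩)
≡-both = scheme (𝐚 ≡ᵗ 𝐜 ∷ 𝐛 ≡ᵗ 𝐝 ∷ []) (⟨ 𝐚 , 𝐛 ⟩ ≡ᵗ ⟨ 𝐜 , 𝐝 ⟩)

schemes : List (Scheme 8)
schemes = ≮-fst ∷ ≢-fst ∷ <-snd ∷ ≮-snd ∷ ≢-snd ∷ ≡-both ∷ []

Γ : EnumerationOperator
Γ = operator <-fst schemes

-- The image structure and the correctness of the operator

module _ (A : Structure) where
  open Structure A using (_≺_)

  InRow : ℕ → ℕ → Set
  InRow a b = ∃₂ λ p q → diagram A (suc (b + p) <ˢ a) × diagram A (a <ˢ suc (b + q)) × Dom A b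

  Lex : Rel (ℕ × ℕ) 0ℓ
  Lex = ×-Lex _≡_ _≺_ _≺_

  image : Structure
  image = record
    { Dom = λ n → InRow (π₁ n) (π₂ n)
    ; _≺_ = λ m n → Lex (π₁ m , π₂ m) (π₁ n , π₂ n)
    }

  InRow⇒Dom-image : ∀ {a b} → InRow a b → Dom image (pair a b)
  InRow⇒Dom-image {a} {b} = subst₂ InRow (sym (π₁-pair a b)) (sym (π₂-pair a b))

  Lex⇔≺-image : ∀ {a b c d} → Lex (a , b) (c , d) ⇔ Structure._≺_ image (pair a b) (pair c d)
  Lex⇔≺-image {a} {b} {c} {d}
    rewrite π₁-pair a b | π₂-pair a b | π₁-pair c d | π₂-pair c d = mk⇔ id id

  InRow⇒Dom₁ : ∀ {a b} → InRow a b → Dom A a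
  InRow⇒Dom₁ (_ , _ , (_ , a∈ , _) , _) = a∈

  InRow⇒Dom₂ : ∀ {a b} → InRow a b → Dom A b
  InRow⇒Dom₂ (_ , _ , _ , _ , b∈) = b∈

  InRow-intro : ∀ {a b w z} → 
    Dom A b → diagram A (w <ˢ a) → diagram A (a <ˢ z) → b < w → b < z → InRow a b
  InRow-intro {a} {b} {w} {z} b∈ w<a a<z b<w b<z = w ∸ suc b , z ∸ suc b ,
    subst (λ x → diagram A (x <ˢ a)) (sym (m+[n∸m]≡n b<w)) w<a ,
    subst (λ x → diagram A (a <ˢ x)) (sym (m+[n∸m]≡n b<z)) a<z ,
    b∈

module _ (A : Structure) (A-linear : IsLinear (relation A)) where
  private
    module A = IsStrictTotalOrder A-linear
    open Structure A using (_≺_)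

  -- Unpairing embeds the image into the lexicographic square of A, and linearity pulls back along
  -- embeddings.
  image-linear : IsLinear (relation (image A))
  image-linear = OrderMonomorphism.isStrictTotalOrder split (isLinear (order · order))
    where
    order : LinearOrder
    order = record { isStrictTotalOrder = A-linear }
    split : IsOrderMonomorphism _ (StrictTotalOrder._≈_ (order · order))
                                _ (StrictTotalOrder._<_ (order · order))
              (λ (n , n∈) → (π₁ n , InRow⇒Dom₁ A n∈) , (π₂ n , InRow⇒Dom₂ A n∈))
    split = record
      { isOrderHomomorphism = record
        { cong = λ eq → cong π₁ eq , cong π₂ eq
        ; mono = id
        }
      ; injective = λ { {m , _} {n , _} (eq₁ , eq₂) →
          trans (sym (pair-π m)) (trans (cong₂ pair eq₁ eq₂) (pair-π n)) }
      ; cancel    = id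
      }

  private
    irrefl : ∀ {m n} → Dom A m → m ≡ n → ¬ (m ≺ n)
    irrefl m∈ refl = A.irrefl {_ , m∈} {_ , m∈} refl

    asym : ∀ {m n} → Dom A m → Dom A n → m ≺ n → ¬ (n ≺ m)
    asym m∈ n∈ = A.asym {_ , m∈} {_ , n∈}

  premises : ∀ a b p q c d r s ls →
    let ρ = a ∷ b ∷ p ∷ q ∷ c ∷ d ∷ r ∷ s ∷ [] in
    All (diagram A) (List.map (ground ρ) (two-rows ls)) →
    Dom (image A) (pair a b) × Dom (image A) (pair c d) × All (diagram A) (List.map (ground ρ) ls)
  premises _ _ p q _ _ r s _ (w≺a ∷ a≺z ∷ (b∈ , _) ∷ w≺c ∷ c≺z ∷ (d∈ , _) ∷ rest) =
    InRow⇒Dom-image A (p , q , w≺a , a≺z , b∈) , InRow⇒Dom-image A (r , s , w≺c , c≺z , d∈) , rest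

  scheme-sound : ∀ {t} → t ∈ <-fst ∷ schemes → ∀ ρ →
                 All (diagram A) (List.map (ground ρ) (proj₁ t)) →
                 diagram (image A) (ground ρ (proj₂ t))
  scheme-sound t∈ (a ∷ b ∷ p ∷ q ∷ c ∷ d ∷ r ∷ s ∷ []) α with t∈
  ... | here refl
    with m∈ , n∈ , (_ , _ , a≺c) ∷ []
       ← premises a b p q c d r s (𝐚 <ᵗ 𝐜 ∷ []) α =
    m∈ , n∈ , Equivalence.to (Lex⇔≺-image A {a} {b} {c} {d}) (inj₁ a≺c)
  ... | there (here refl)
    with m∈ , n∈ , (c∈ , a∈ , c≺a) ∷ []
       ← premises a b p q c d r s (𝐜 <ᵗ 𝐚 ∷ []) α =
    m∈ , n∈ , λ m≺n → case Equivalence.from (Lex⇔≺-image A {a} {b} {c} {d}) m≺n of λ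
      { (inj₁ a≺c)       → asym a∈ c∈ a≺c c≺a
      ; (inj₂ (a≡c , _)) → irrefl c∈ (sym a≡c) c≺a }
  ... | there (there (here refl))
    with m∈ , n∈ , (_ , _ , a≢c) ∷ []
       ← premises a b p q c d r s (𝐚 ≢ᵗ 𝐜 ∷ []) α =
    m∈ , n∈ , a≢c ∘ proj₁ ∘ pair-injective {a} {b} {c} {d}
  ... | there (there (there (here refl)))
    with m∈ , n∈ , (_ , _ , a≡c) ∷ (_ , _ , b≺d) ∷ []
       ← premises a b p q c d r s (𝐚 ≡ᵗ 𝐜 ∷ 𝐛 <ᵗ 𝐝 ∷ []) α =
    m∈ , n∈ , Equivalence.to (Lex⇔≺-image A {a} {b} {c} {d}) (inj₂ (a≡c , b≺d))
  ... | there (there (there (there (here refl))))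
    with m∈ , n∈ , (a∈ , _ , a≡c) ∷ (_ , _ , b⊀d) ∷ []
       ← premises a b p q c d r s (𝐚 ≡ᵗ 𝐜 ∷ 𝐛 ≮ᵗ 𝐝 ∷ []) α =
    m∈ , n∈ , λ m≺n → case Equivalence.from (Lex⇔≺-image A {a} {b} {c} {d}) m≺n of λ
      { (inj₁ a≺c)       → irrefl a∈ a≡c a≺c
      ; (inj₂ (_ , b≺d)) → b⊀d b≺d }
  ... | there (there (there (there (there (here refl)))))
    with m∈ , n∈ , (_ , _ , b≢d) ∷ []
       ← premises a b p q c d r s (𝐛 ≢ᵗ 𝐝 ∷ []) α =
    m∈ , n∈ , b≢d ∘ proj₂ ∘ pair-injective {a} {b} {c} {d}
  ... | there (there (there (there (there (there (here refl))))))
    with m∈ , n∈ , (_ , _ , a≡c) ∷ (_ , _ , b≡d) ∷ []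
       ← premises a b p q c d r s (𝐚 ≡ᵗ 𝐜 ∷ 𝐛 ≡ᵗ 𝐝 ∷ []) α =
    m∈ , n∈ , cong₂ pair a≡c b≡d

  derive : ∀ t → t ∈ <-fst ∷ schemes → ∀ ρ →
           All (diagram A) (List.map (ground ρ) (proj₁ t)) →
           apply Γ (diagram A) (ground ρ (proj₂ t))
  derive _ t∈ ρ α = _ , ∈⇒Instance t∈ ρ , α

  module _ {a b c d} (row : InRow A a b) (row′ : InRow A c d) where
    private
      p = proj₁ row
      q = proj₁ (proj₂ row)
      r = proj₁ row′
      s = proj₁ (proj₂ row′)
      ρ : Vec ℕ 8
      ρ = a ∷ b ∷ p ∷ q ∷ c ∷ d ∷ r ∷ s ∷ []
      a∈ = InRow⇒Dom₁ A row
      b∈ = InRow⇒Dom₂ A row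
      c∈ = InRow⇒Dom₁ A row′
      d∈ = InRow⇒Dom₂ A row′

      rows : ∀ {φs} → All (diagram A) φs →
             All (diagram A) (suc (b + p) <ˢ a ∷ a <ˢ suc (b + q) ∷ b ≡ˢ b ∷
                              suc (d + r) <ˢ c ∷ c <ˢ suc (d + s) ∷ d ≡ˢ d ∷ φs)
      rows rest =
        let _ , _ , w≺a , a≺z , _ = row
            _ , _ , w≺c , c≺z , _ = row′
        in w≺a ∷ a≺z ∷ (b∈ , b∈ , refl) ∷ w≺c ∷ c≺z ∷ (d∈ , d∈ , refl) ∷ rest

    complete-< : Lex A (a , b) (c , d) → apply Γ (diagram A) (pair a b <ˢ pair c d)
    complete-< (inj₁ a≺c)         = derive <-fst (here refl) ρ (rows ((a∈ , c∈ , a≺c) ∷ []))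
    complete-< (inj₂ (a≡c , b≺d)) = derive <-snd (there (there (there (here refl)))) ρ
                                      (rows ((a∈ , c∈ , a≡c) ∷ (b∈ , d∈ , b≺d) ∷ []))

    complete-≮ : ¬ Lex A (a , b) (c , d) → apply Γ (diagram A) (pair a b ≮ˢ pair c d)
    complete-≮ ≮ with A.compare (a , a∈) (c , c∈)
    ... | tri< a≺c _ _ = contradiction (inj₁ a≺c) ≮
    ... | tri≈ _ a≡c _ = derive ≮-snd (there (there (there (there (here refl))))) ρ
                           (rows ((a∈ , c∈ , a≡c) ∷ (b∈ , d∈ , λ b≺d → ≮ (inj₂ (a≡c , b≺d))) ∷ []))
    ... | tri> _ _ c≺a = derive ≮-fst (there (here refl)) ρ (rows ((c∈ , a∈ , c≺a) ∷ []))

    complete-≡ : a ≡ c → b ≡ d → apply Γ (diagram A) (pair a b ≡ˢ pair c d)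
    complete-≡ a≡c b≡d = derive ≡-both (there (there (there (there (there (there (here refl))))))) ρ
                           (rows ((a∈ , c∈ , a≡c) ∷ (b∈ , d∈ , b≡d) ∷ []))

    complete-≢ : pair a b ≢ pair c d → apply Γ (diagram A) (pair a b ≢ˢ pair c d)
    complete-≢ ≢ with a ≟ c
    ... | no a≢c  = derive ≢-fst (there (there (here refl))) ρ (rows ((a∈ , c∈ , a≢c) ∷ []))
    ... | yes a≡c = derive ≢-snd (there (there (there (there (there (here refl)))))) ρ
                      (rows ((b∈ , d∈ , λ b≡d → ≢ (cong₂ pair a≡c b≡d)) ∷ []))

  Γ-complete : ∀ φ → diagram (image A) φ → apply Γ (diagram A) φ
  Γ-complete (m <ˢ n) (m∈ , n∈ , m≺n) =
    subst₂ (λ x y → apply Γ (diagram A) (x <ˢ y)) (pair-π m) (pair-π n) (complete-< m∈ n∈ m≺n)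
  Γ-complete (m ≮ˢ n) (m∈ , n∈ , m⊀n) =
    subst₂ (λ x y → apply Γ (diagram A) (x ≮ˢ y)) (pair-π m) (pair-π n) (complete-≮ m∈ n∈ m⊀n)
  Γ-complete (m ≡ˢ n) (m∈ , n∈ , m≡n) =
    subst₂ (λ x y → apply Γ (diagram A) (x ≡ˢ y)) (pair-π m) (pair-π n)
           (complete-≡ m∈ n∈ (cong π₁ m≡n) (cong π₂ m≡n))
  Γ-complete (m ≢ˢ n) (m∈ , n∈ , m≢n) =
    subst₂ (λ x y → apply Γ (diagram A) (x ≢ˢ y)) (pair-π m) (pair-π n)
           (complete-≢ m∈ n∈ (subst₂ _≢_ (sym (pair-π m)) (sym (pair-π n)) m≢n))

  image-isImage : image A isImageOf A under Γ
  image-isImage φ = mk⇔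
    (λ (_ , axiom , α) → sound axiom α)
    (Γ-complete φ)
    where
    sound : ∀ {α φ} → EnumerationOperator.Axiom Γ (α , φ) → All (diagram A) α → diagram (image A) φ
    sound axiom α with Instance⇒∈ schemes axiom
    ... | _ , t∈ , ρ , refl = scheme-sound t∈ ρ α

-- Order type ω

-- Pigeonhole: if no value exceeded b, the first 2 + b values would inject into 1 + b numbers.
injective⇒unbounded : ∀ {u : ℕ → ℕ} → Injective _≡_ _≡_ u → ∀ b → ∃ λ n → b < u n
injective⇒unbounded {u} u-injective b with Fin.any? {n = 2 + b} (λ i → b <? u (toℕ i))
... | yes (i , b<ui) = toℕ i , b<ui
... | no  bounded    = contradiction (Fin.injective⇒≤ {f = f} f-injective) 1+n≰n
  where
  bound : ∀ i → u (toℕ i) < suc b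
  bound i = s≤s (≮⇒≥ λ b<ui → bounded (i , b<ui))
  f : Fin (2 + b) → Fin (1 + b)
  f i = fromℕ< (bound i)
  f-injective : Injective _≡_ _≡_ f
  f-injective {i} {j} eq = Fin.toℕ-injective (u-injective
    (trans (sym (Fin.toℕ-fromℕ< (bound i))) (trans (cong toℕ eq) (Fin.toℕ-fromℕ< (bound j)))))

initial-bound : ∀ (u : ℕ → ℕ) n → ∃ λ M → ∀ {k} → k ≤ n → u k ≤ M
initial-bound u zero    = u 0 , λ { z≤n → ≤-refl }
initial-bound u (suc n) with M , bound ← initial-bound u n =
  M ⊔ u (suc n) , λ {k} k≤1+n → case m≤n⇒m<n∨m≡n k≤1+n of λ
    { (inj₁ k<1+n) → m≤n⇒m≤n⊔o _ (bound (s≤s⁻¹ k<1+n))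
    ; (inj₂ refl)  → m≤n⊔m M _ }

step⇒monotone : ∀ {X : Set} {_⊏_ : Rel X 0ℓ} → Transitive _⊏_ → (u : ℕ → X) →
                (∀ n → u n ⊏ u (suc n)) → ∀ {m n} → m < n → u m ⊏ u n
step⇒monotone {_⊏_ = _⊏_} ⊏-trans u step = go
  where
  go : ∀ {m n} → m < n → u m ⊏ u n
  go {m} {suc n} (s≤s m≤n) with m≤n⇒m<n∨m≡n m≤n
  ... | inj₁ m<n  = ⊏-trans (go m<n) (step n)
  ... | inj₂ refl = step m

FinitelyManyBelow : Structure → Pred ℕ 0ℓ
FinitelyManyBelow S s = ∃ λ N → ∀ {t} → Dom S t → Structure._≺_ S t s → t < N

module _ (em : ExcludedMiddle 0ℓ) (S : Structure) (S-linear : IsLinear (relation S)) where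
  open Structure S using (_≺_)
  private module S = IsStrictTotalOrder S-linear

  Least : Pred ℕ 0ℓ → ℕ → Set
  Least Q m = Dom S m × Q m × (∀ {t} → Dom S t → Q t → ¬ (t ≺ m))

  -- Search through the numbers below N, keeping the `≺`-least hit; excluded middle decides whether
  -- the next number is a hit that improves on it.
  least-below : (Q : Pred ℕ 0ℓ) → ∀ N →
    (∀ {t} → t < N → Dom S t → ¬ Q t) ⊎
    (∃ λ m → Dom S m × Q m × (∀ {t} → t < N → Dom S t → Q t → ¬ (t ≺ m)))
  least-below Q zero = inj₁ λ ()
  least-below Q (suc N) with least-below Q N
  ... | inj₁ none with em {Dom S N × Q N}
  ...   | yes (N∈ , QN) = inj₂ (N , N∈ , QN , λ t<1+N t∈ Qt t≺N →
            case m≤n⇒m<n∨m≡n (s≤s⁻¹ t<1+N) of λ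
            { (inj₁ t<N)  → none t<N t∈ Qt
            ; (inj₂ refl) → S.irrefl {_ , t∈} {_ , N∈} refl t≺N })
  ...   | no ¬QN = inj₁ λ t<1+N t∈ Qt → case m≤n⇒m<n∨m≡n (s≤s⁻¹ t<1+N) of λ
            { (inj₁ t<N)  → none t<N t∈ Qt
            ; (inj₂ refl) → ¬QN (t∈ , Qt) }
  least-below Q (suc N) | inj₂ (m , m∈ , Qm , least) with em {Dom S N × Q N × N ≺ m}
  ...   | yes (N∈ , QN , N≺m) = inj₂ (N , N∈ , QN , λ t<1+N t∈ Qt t≺N →
            case m≤n⇒m<n∨m≡n (s≤s⁻¹ t<1+N) of λ
            { (inj₁ t<N)  → least t<N t∈ Qt (S.trans {_ , t∈} {_ , N∈} {_ , m∈} t≺N N≺m)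
            ; (inj₂ refl) → S.irrefl {_ , t∈} {_ , N∈} refl t≺N })
  ...   | no ¬N≺m = inj₂ (m , m∈ , Qm , λ t<1+N t∈ Qt t≺m →
            case m≤n⇒m<n∨m≡n (s≤s⁻¹ t<1+N) of λ
            { (inj₁ t<N)  → least t<N t∈ Qt t≺m
            ; (inj₂ refl) → ¬N≺m (t∈ , Qt , t≺m) })

  least-exists : (∀ {s} → Dom S s → FinitelyManyBelow S s) →
                 (Q : Pred ℕ 0ℓ) → ∀ {s} → Dom S s → Q s → ∃ (Least Q)
  -- The bound `suc s` puts s among the candidates and N everything `≺ s`. The minimum m found is
  -- not above s, so whatever lies below m has been searched too.
  least-exists finite Q {s} s∈ Qs with N , bound ← finite s∈ with least-below Q (suc s ⊔ N)
  ... | inj₁ none = contradiction Qs (none (m≤m⊔n (suc s) N) s∈)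
  ... | inj₂ (m , m∈ , Qm , least) = m , m∈ , Qm , λ t∈ Qt t≺m →
    least (≤-trans (bound t∈ (below-s t∈ t≺m)) (m≤n⊔m (suc s) N)) t∈ Qt t≺m
    where
    below-s : ∀ {t} → Dom S t → t ≺ m → t ≺ s
    below-s t∈ t≺m with S.compare (m , m∈) (s , s∈)
    ... | tri< m≺s _ _  = S.trans {_ , t∈} {_ , m∈} {_ , s∈} t≺m m≺s
    ... | tri≈ _ refl _ = t≺m
    ... | tri> _ _ s≺m  = contradiction s≺m (least (m≤m⊔n (suc s) N) s∈ Qs)

  module Enumeration
    (finite : ∀ {s} → Dom S s → FinitelyManyBelow S s)
    (unbounded : ∀ {s} → Dom S s → ∃ λ t → Dom S t × s ≺ t)
    (inhabited : ∃ (Dom S))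
    where

    private
      first : ∃ (Least (λ _ → ⊤))
      first = least-exists finite (λ _ → ⊤) (proj₂ inhabited) tt

      next : ∀ {s} → Dom S s → ∃ (Least (s ≺_))
      next {s} s∈ with t , t∈ , s≺t ← unbounded s∈ = least-exists finite (s ≺_) t∈ s≺t

    enumerate : ℕ → Σ ℕ (Dom S)
    enumerate zero    = proj₁ first , proj₁ (proj₂ first)
    enumerate (suc n) = let t , t∈ , _ = next (proj₂ (enumerate n)) in t , t∈

    element : ℕ → ℕ
    element n = proj₁ (enumerate n)

    element-monotone : ∀ {m n} → m < n → element m ≺ element n
    element-monotone = step⇒monotone {_⊏_ = _≺_ on proj₁}
      (λ {x} {y} {z} → S.trans {x} {y} {z}) enumerate
      (λ n → proj₁ (proj₂ (proj₂ (next (proj₂ (enumerate n))))))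

    element-injective : Injective _≡_ _≡_ element
    element-injective {m} {n} eq with <-cmp m n
    ... | tri< m<n _ _ = contradiction (element-monotone m<n) (S.irrefl {enumerate m} {enumerate n} eq)
    ... | tri≈ _ m≡n _ = m≡n
    ... | tri> _ _ n<m = contradiction (element-monotone n<m) (S.irrefl {enumerate n} {enumerate m} (sym eq))

    -- Only numbers below N precede s, and the injective enumeration exceeds N somewhere, so s is at
    -- or before some `enumerate n`. Descending from there, minimality in `next` leaves no gap for
    -- s.
    element-surjective : ∀ {s} → Dom S s → ∃ λ n → element n ≡ s
    element-surjective {s} s∈ = beyond
      where
      below : ∀ n → s ≺ element n → ∃ λ k → element k ≡ s
      below zero s≺e = contradiction s≺e (proj₂ (proj₂ (proj₂ first)) s∈ tt)
      below (suc n) s≺e with S.compare (s , s∈) (enumerate n)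
      ... | tri< s≺eₙ _ _ = below n s≺eₙ
      ... | tri≈ _ s≡eₙ _ = n , sym s≡eₙ
      ... | tri> _ _ eₙ≺s = contradiction s≺e
        (proj₂ (proj₂ (proj₂ (next (proj₂ (enumerate n))))) s∈ eₙ≺s)
      beyond : ∃ λ k → element k ≡ s
      beyond with N , bound ← finite s∈
        with n , N<eₙ ← injective⇒unbounded element-injective N
        with S.compare (s , s∈) (enumerate n)
      ... | tri< s≺eₙ _ _ = below n s≺eₙ
      ... | tri≈ _ s≡eₙ _ = n , sym s≡eₙ
      ... | tri> _ _ eₙ≺s = contradiction (bound (proj₂ (enumerate n)) eₙ≺s) (<-asym N<eₙ)

    ω≅ : rawRelation ω ≅ relation S
    ω≅ = monotone-surjection⇒≅ (isLinear ω) S-linear enumerate (cong element) element-monotone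
      (λ (_ , s∈) → let n , eq = element-surjective s∈ in n , λ { refl → eq })

-- ω ≅ 𝟚 · ω

half : ℕ → ℕ × Fin 2
half 0             = 0 , 0F
half 1             = 0 , 1F
half (suc (suc n)) = map₁ suc (half n)

half-monotone : ∀ {m n} → m < n → StrictTotalOrder._<_ (𝟚 · ω) (half m) (half n)
half-monotone = step⇒monotone (λ {x} {y} {z} → StrictTotalOrder.trans (𝟚 · ω) {x} {y} {z}) half step
  where
  step : ∀ n → StrictTotalOrder._<_ (𝟚 · ω) (half n) (half (suc n))
  step 0 = inj₂ (refl , s≤s z≤n)
  step 1 = inj₁ (s≤s z≤n)
  step (suc (suc n)) with step n
  ... | inj₁ lt        = inj₁ (s≤s lt)
  ... | inj₂ (eq , lt) = inj₂ (cong suc eq , lt)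

half-surjective : ∀ k i → ∃ λ n → half n ≡ (k , i)
half-surjective zero    0F = 0 , refl
half-surjective zero    1F = 1 , refl
half-surjective (suc k) i with n , eq ← half-surjective k i = suc (suc n) , cong (map₁ suc) eq

-- The image of ω · 2

module _ (em : ExcludedMiddle 0ℓ) (A : Structure) (A-linear : IsLinear (relation A))
         (ω·2≅A : rawRelation (ω · 𝟚) ≅ relation A) where
  open Structure A using (_≺_)

  private
    module G = IsOrderIsomorphism (proj₂ ω·2≅A)

    g : Fin 2 → ℕ → ℕ
    g i n = proj₁ (proj₁ ω·2≅A (i , n))

    g∈ : ∀ i n → Dom A (g i n)
    g∈ i n = proj₂ (proj₁ ω·2≅A (i , n))

    g-surjective : ∀ {x} → Dom A x → ∃₂ λ i n → g i n ≡ x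
    g-surjective x∈ with (i , n) , eq ← G.surjective (_ , x∈) = i , n , eq (refl , refl)

    g-injective : ∀ {i} → Injective _≡_ _≡_ (g i)
    g-injective = proj₂ ∘ G.injective

    across : ∀ {m n} → g 0F m ≺ g 1F n
    across = G.mono (inj₁ (s≤s z≤n))

    along : ∀ {i m n} → m < n → g i m ≺ g i n
    along m<n = G.mono (inj₂ (refl , m<n))

    literal : ∀ {i m j n} → g i m ≺ g j n → diagram A (g i m <ˢ g j n)
    literal lt = g∈ _ _ , g∈ _ _ , lt

    -- Copy i from index k + 1 on is still an injective sequence of numbers, hence unbounded.
    shift : ∀ k b i → ∃ λ n → k < n × b < g i n
    shift k b i with n , lt ← injective⇒unbounded {λ n → g i (suc (k + n))}
                                (λ eq → +-cancelˡ-≡ k _ _ (suc-injective (g-injective eq))) b =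
      suc (k + n) , s≤s (m≤m+n k n) , lt

    -- The whole first copy lies below `g 1F k` and a tail of the second above it; each contains a
    -- number above b.
    row-unbounded : ∀ {b} → Dom A b → ∀ k → InRow A (g 1F k) b
    row-unbounded {b} b∈ k
      with m , _ , b<w ← shift 0 b 0F
      with n , k<n , b<z ← shift k b 1F =
      InRow-intro A b∈ (literal (across {m} {k})) (literal (along k<n)) b<w b<z

    -- The entry b = `g 0F 0` stays fixed. A late m with `g 0F m` numerically above b supplies the
    -- lower witness for row m + 1, so nonempty rows recur forever.
    finite-row-inhabited : ∀ k → ∃₂ λ n b → k < n × InRow A (g 0F n) b
    finite-row-inhabited k
      with m , k<m , b<w ← shift k (g 0F 0) 0F
      with n , m<n , b<z ← shift (suc m) (g 0F 0) 0F =
      suc m , g 0F 0 , m<n⇒m<1+n k<m ,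
      InRow-intro A (g∈ 0F 0) (literal (along (n<1+n m))) (literal (along m<n)) b<w b<z

    -- Nothing of the second copy lies below `g 0F n`, so the lower witness is some `g 0F k` with k
    -- < n, and it exceeds b.
    finite-row-bound : ∀ {n M b} → (∀ {k} → k ≤ n → g 0F k ≤ M) → InRow A (g 0F n) b → b < M
    finite-row-bound {n} bound (p , q , (w∈ , _ , w≺a) , _) with g-surjective w∈
    ... | i , k , eq with G.cancel {i , k} {0F , n} (subst (_≺ g 0F n) (sym eq) w≺a)
    ...   | inj₂ (refl , k<n) = ≤-trans (s≤s (m≤m+n _ p)) (subst (_≤ _) eq (bound (<⇒≤ k<n)))

    finiteRows : Structure
    finiteRows = record
      { Dom = λ s → Dom (image A) s × ∃ λ n → g 0F n ≡ π₁ s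
      ; _≺_ = Structure._≺_ (image A)
      }

    finiteRows-linear : IsLinear (relation finiteRows)
    finiteRows-linear = OrderMonomorphism.isStrictTotalOrder inclusion (image-linear A A-linear)
      where
      inclusion : IsOrderMonomorphism _ (RawRelation._≈_ (relation (image A)))
                                      _ (RawRelation._∼_ (relation (image A)))
                    (λ (s , s∈) → s , proj₁ s∈)
      inclusion = record
        { isOrderHomomorphism = record { cong = id ; mono = id }
        ; injective = id
        ; cancel    = id
        }

    -- A predecessor of s lies in a row m ≤ n, so both its coordinates are at most M, and `pair` is
    -- monotone.
    finite : ∀ {s} → Dom finiteRows s → FinitelyManyBelow finiteRows s
    finite {s} (_ , n , gn≡π₁s) with M , bound ← initial-bound (g 0F) n = suc (pair M M) , below
      where
      row-≤ : ∀ {t m} → g 0F m ≡ π₁ t → Structure._≺_ finiteRows t s → m ≤ n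
      row-≤ gm≡π₁t (inj₂ (π₁t≡π₁s , _)) =
        ≤-reflexive (g-injective (trans gm≡π₁t (trans π₁t≡π₁s (sym gn≡π₁s))))
      row-≤ {m = m} gm≡π₁t (inj₁ π₁t≺π₁s)
        with G.cancel {0F , m} {0F , n} (subst₂ _≺_ (sym gm≡π₁t) (sym gn≡π₁s) π₁t≺π₁s)
      ... | inj₂ (_ , m<n) = <⇒≤ m<n

      below : ∀ {t} → Dom finiteRows t → Structure._≺_ finiteRows t s → t < suc (pair M M)
      below {t} (row , m , gm≡π₁t) t≺s = s≤s (subst (_≤ pair M M) (pair-π t)
        (pair-mono (subst (_≤ M) gm≡π₁t (bound m≤n))
                   (<⇒≤ (finite-row-bound (λ k≤m → bound (≤-trans k≤m m≤n))
                                          (subst (λ a → InRow A a (π₂ t)) (sym gm≡π₁t) row)))))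
        where
        m≤n : m ≤ n
        m≤n = row-≤ {t} gm≡π₁t t≺s

    later-row : ∀ k → ∃ λ t → Dom finiteRows t × g 0F k ≺ π₁ t
    later-row k =
      let n , b , k<n , row = finite-row-inhabited k in
      pair (g 0F n) b ,
      (InRow⇒Dom-image A {g 0F n} {b} row , n , sym (π₁-pair (g 0F n) b)) ,
      subst (g 0F k ≺_) (sym (π₁-pair (g 0F n) b)) (along k<n)

    unbounded : ∀ {s} → Dom finiteRows s → ∃ λ t → Dom finiteRows t × Structure._≺_ finiteRows s t
    unbounded (_ , n , gn≡π₁s) =
      let t , t∈ , lt = later-row n in
      t , t∈ , inj₁ (subst (_≺ π₁ t) gn≡π₁s lt)

    inhabited : ∃ (Dom finiteRows)
    inhabited = let t , t∈ , _ = later-row 0 in t , t∈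

    module Placement (ω≅finiteRows : rawRelation ω ≅ relation finiteRows) where
      private module E = IsOrderIsomorphism (proj₂ ω≅finiteRows)

      enumerate : ℕ → Σ ℕ (Dom finiteRows)
      enumerate = proj₁ ω≅finiteRows

      -- Row 0 of ω² is the union of the finite rows of the image, and row 1 + c
      -- is the i-th copy of ω in row g 1F k of the image, where c = 2k + i.
      place : ℕ × ℕ → ℕ
      place (0     , m) = proj₁ (enumerate m)
      place (suc c , m) = let k , i = half c in pair (g 1F k) (g i m)

      place∈ : ∀ x → Dom (image A) (place x)
      place∈ (0     , m) = proj₁ (proj₂ (enumerate m))
      place∈ (suc c , m) =
        InRow⇒Dom-image A {g 1F (proj₁ (half c))} {g (proj₂ (half c)) m}
          (row-unbounded (g∈ _ m) (proj₁ (half c)))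

      place-monotone : ∀ {x y} → StrictTotalOrder._<_ ω² x y →
                       Structure._≺_ (image A) (place x) (place y)
      place-monotone {0 , m} {0 , n} (inj₂ (_ , m<n)) = E.mono m<n
      place-monotone {0 , m} {suc c , n} (inj₁ _) =
        let _ , k , gk≡π₁ = proj₂ (enumerate m) in
        inj₁ (subst₂ _≺_ gk≡π₁ (sym (π₁-pair (g 1F (proj₁ (half c))) (g (proj₂ (half c)) n))) across)
      place-monotone {suc c , m} {suc .c , n} (inj₂ (refl , m<n)) =
        Equivalence.to (Lex⇔≺-image A {g 1F (proj₁ (half c))} {g (proj₂ (half c)) m}
                                      {g 1F (proj₁ (half c))} {g (proj₂ (half c)) n})
          (inj₂ (refl , along m<n))
      -- Either the row of the image moves on, or it stays the same and the step goes from its first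
      -- copy of ω to its second.
      place-monotone {suc c , m} {suc e , n} (inj₁ (s≤s c<e)) =
        Equivalence.to (Lex⇔≺-image A {g 1F (proj₁ (half c))} {g (proj₂ (half c)) m}
                                      {g 1F (proj₁ (half e))} {g (proj₂ (half e)) n})
          (Sum.map along (λ (k≡l , i<j) → cong (g 1F) k≡l , G.mono (inj₁ i<j)) (half-monotone c<e))

      place-surjective : ∀ {s} → Dom (image A) s → ∃ λ x → place x ≡ s
      place-surjective {s} s∈ with g-surjective (InRow⇒Dom₁ A s∈)
      ... | 0F , n , eq with m , eq′ ← E.surjective (s , s∈ , n , eq) = (0 , m) , eq′ refl
      ... | 1F , k , eq
        with i , m , eq′ ← g-surjective (InRow⇒Dom₂ A s∈)
        with c , eq″ ← half-surjective k i =
        (suc c , m) ,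
        trans (cong (λ (k , i) → pair (g 1F k) (g i m)) eq″) (trans (cong₂ pair eq eq′) (pair-π s))

      image≅ω² : relation (image A) ≅ rawRelation ω²
      image≅ω² = ≅-sym (image-linear A A-linear)
        (monotone-surjection⇒≅ (isLinear ω²) (image-linear A A-linear)
          (λ x → place x , place∈ x)
          (λ { (refl , refl) → refl })
          place-monotone
          (λ (s , s∈) → let x , eq = place-surjective s∈ in x , λ { (refl , refl) → eq }))

  image≅ω² : relation (image A) ≅ rawRelation ω²
  image≅ω² = Placement.image≅ω²
    (Enumeration.ω≅ em finiteRows finiteRows-linear
      (λ {s} → finite {s}) (λ {s} → unbounded {s}) inhabited)

image-ω·2≅ω² : ExcludedMiddle 0ℓ → ∀ A → relation A ≅ rawRelation (ω · 𝟚) →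
               relation (image A) ≅ rawRelation ω²
image-ω·2≅ω² em A A≅ω·2 =
  image≅ω² em A (≅-linear A≅ω·2 (isLinear (ω · 𝟚))) (≅-sym (isLinear (ω · 𝟚)) A≅ω·2)

-- Duality

opp : Structure → Structure
opp A = record { Dom = Dom A ; _≺_ = flip (Structure._≺_ A) }

opp-≅ : ∀ A L → relation A ≅ rawRelation L → relation (opp A) ≅ rawRelation (L ⋆)
opp-≅ A L (f , iso) = f , record
  { isOrderMonomorphism = record
    { isOrderHomomorphism = record { cong = L.Eq.sym ∘ F.cong ; mono = F.mono }
    ; injective = F.injective ∘ L.Eq.sym
    ; cancel    = F.cancel
    }
  ; surjective = λ y → let x , fx≈y = F.surjective y in x , L.Eq.sym ∘ fx≈y
  }
  where
  module F = IsOrderIsomorphism iso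
  module L = StrictTotalOrder L

InRow-opp : ∀ A {a b} → InRow A a b → InRow (opp A) a b
InRow-opp A (p , q , (w∈ , a∈ , w≺a) , (_ , z∈ , a≺z) , b∈) =
  q , p , (z∈ , a∈ , a≺z) , (a∈ , w∈ , w≺a) , b∈

-- Reversal exchanges the roles of the two witnesses, and a lexicographic order reverses when both
-- coordinates do.
image-opp : ∀ A → relation (opp (image A)) ≅ relation (image (opp A))
image-opp A = domain-≅ (opp (image A)) (image (opp A))
  (λ n → mk⇔ (InRow-opp A {π₁ n} {π₂ n}) (InRow-opp (opp A) {π₁ n} {π₂ n}))
  (λ _ _ → mk⇔ (Sum.map₂ (map₁ sym)) (Sum.map₂ (map₁ sym)))

-- Reversal turns each copy back into ω but also exchanges the copies, which `opposite` undoes.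
ω⋆·𝟚⋆≅ω·𝟚 : rawRelation ((ω ⋆ · 𝟚) ⋆) ≅ rawRelation (ω · 𝟚)
ω⋆·𝟚⋆≅ω·𝟚 = monotone-surjection⇒≅ (isLinear ((ω ⋆ · 𝟚) ⋆)) (isLinear (ω · 𝟚))
  (λ (i , n) → opposite i , n)
  (λ { (refl , refl) → refl , refl })
  (λ { {0F , _} {0F , _} (inj₂ (_ , lt)) → inj₂ (refl , lt)
     ; {1F , _} {0F , _} _ → inj₁ (s≤s z≤n)
     ; {1F , _} {1F , _} (inj₂ (_ , lt)) → inj₂ (refl , lt)
     ; {1F , _} {1F , _} (inj₁ (s≤s ()))
     ; {0F , _} {1F , _} (inj₁ ()) })
  (λ { (0F , n) → (1F , n) , λ { (refl , refl) → refl , refl }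
     ; (1F , n) → (0F , n) , λ { (refl , refl) → refl , refl } })

-- The case of ω · 2 is applied to `opp A` and its result reversed back; `opp` is an involution
-- definitionally.
image-ω⋆·2≅ω²⋆ : ExcludedMiddle 0ℓ → ∀ A → relation A ≅ rawRelation (ω ⋆ · 𝟚) →
                 relation (image A) ≅ rawRelation (ω² ⋆)
image-ω⋆·2≅ω²⋆ em A A≅ = opp-≅ (opp (image A)) ω² (≅-trans (isLinear ω²) (image-opp A)
  (image-ω·2≅ω² em (opp A) (≅-trans (isLinear (ω · 𝟚)) (opp-≅ A (ω ⋆ · 𝟚) A≅) ω⋆·𝟚⋆≅ω·𝟚)))

-- Distinguishing the order types and assembling the embedding

ω·2≇ω⋆·2 : ¬ (rawRelation (ω · 𝟚) ≅ rawRelation (ω ⋆ · 𝟚))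
ω·2≇ω⋆·2 = least≇no-least (isLinear (ω ⋆ · 𝟚))
  ((0F , 0) , λ { _ (inj₁ ()) ; _ (inj₂ ()) })
  (λ (i , n) → (i , suc n) , inj₂ (refl , n<1+n n))

ω²≇ω²⋆ : ¬ (rawRelation ω² ≅ rawRelation (ω² ⋆))
ω²≇ω²⋆ = least≇no-least (isLinear (ω² ⋆))
  ((0 , 0) , λ { _ (inj₁ ()) ; _ (inj₂ ()) })
  (λ (m , n) → (m , suc n) , inj₂ (refl , n<1+n n))

Source Target : Pred Structure 0ℓ
Source = ｛ ω · 𝟚 , ω ⋆ · 𝟚 ｝
Target = ｛ ω² , ω² ⋆ ｝

source-linear : ∀ A → Source A → IsLinear (relation A)
source-linear _ (inj₁ A≅) = ≅-linear A≅ (isLinear (ω · 𝟚))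
source-linear _ (inj₂ A≅) = ≅-linear A≅ (isLinear (ω ⋆ · 𝟚))

image-target : ExcludedMiddle 0ℓ → ∀ A → Source A → Target (image A)
image-target em A = Sum.map (image-ω·2≅ω² em A) (image-ω⋆·2≅ω²⋆ em A)

-- Both structures have `apply Γ (diagram A)` as their diagram. This handles the arbitrary images B
-- over which `iso⇔` quantifies.
imageOf≅image : ∀ A B → Source A → B isImageOf A under Γ → relation B ≅ relation (image A)
imageOf≅image A B A∈ B-image = diagram-≅ B (image A) λ φ →
  mk⇔ (Equivalence.to (image-isImage A (source-linear A A∈) φ) ∘ Equivalence.from (B-image φ))
      (Equivalence.to (B-image φ) ∘ Equivalence.from (image-isImage A (source-linear A A∈) φ))

matching-types : ExcludedMiddle 0ℓ → ∀ A B → Source A → relation B ≅ relation (image A) →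
  (relation A ≅ rawRelation (ω · 𝟚) × relation B ≅ rawRelation ω²) ⊎
  (relation A ≅ rawRelation (ω ⋆ · 𝟚) × relation B ≅ rawRelation (ω² ⋆))
matching-types em A B A∈ B≅ = Sum.map
  (λ A≅ → A≅ , ≅-trans (isLinear ω²) B≅ (image-ω·2≅ω² em A A≅))
  (λ A≅ → A≅ , ≅-trans (isLinear (ω² ⋆)) B≅ (image-ω⋆·2≅ω²⋆ em A A≅))
  A∈

≅-common : ∀ {R S} (L : LinearOrder) → R ≅ rawRelation L → S ≅ rawRelation L → R ≅ S
≅-common L R≅ S≅ = ≅-trans (≅-linear S≅ (isLinear L)) R≅ (≅-sym (isLinear L) S≅)

≇-transport : ∀ {R S} (L M : LinearOrder) → ¬ (rawRelation L ≅ rawRelation M) →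
              R ≅ rawRelation L → S ≅ rawRelation M → ¬ (R ≅ S)
≇-transport L M L≇M R≅L S≅M R≅S =
  L≇M (≅-trans (isLinear M) (≅-sym (isLinear L) R≅L) (≅-trans (isLinear M) R≅S S≅M))

-- Both sides hold when the two types agree, and both fail when they differ.
≅⇔≅ : ∀ {R R′ S S′} (K L M N : LinearOrder) →
  ¬ (rawRelation K ≅ rawRelation L) → ¬ (rawRelation M ≅ rawRelation N) →
  (R ≅ rawRelation K × S ≅ rawRelation M) ⊎ (R ≅ rawRelation L × S ≅ rawRelation N) →
  (R′ ≅ rawRelation K × S′ ≅ rawRelation M) ⊎ (R′ ≅ rawRelation L × S′ ≅ rawRelation N) →
  R ≅ R′ ⇔ S ≅ S′
≅⇔≅ K L M N K≇L M≇N (inj₁ (R≅ , S≅)) (inj₁ (R′≅ , S′≅)) =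
  mk⇔ (λ _ → ≅-common M S≅ S′≅) (λ _ → ≅-common K R≅ R′≅)
≅⇔≅ K L M N K≇L M≇N (inj₂ (R≅ , S≅)) (inj₂ (R′≅ , S′≅)) =
  mk⇔ (λ _ → ≅-common N S≅ S′≅) (λ _ → ≅-common L R≅ R′≅)
≅⇔≅ K L M N K≇L M≇N (inj₁ (R≅ , S≅)) (inj₂ (R′≅ , S′≅)) =
  mk⇔ (λ R≅R′ → contradiction R≅R′ (≇-transport K L K≇L R≅ R′≅))
      (λ S≅S′ → contradiction S≅S′ (≇-transport M N M≇N S≅ S′≅))
≅⇔≅ K L M N K≇L M≇N (inj₂ (R≅ , S≅)) (inj₁ (R′≅ , S′≅)) =
  mk⇔ (λ R≅R′ → contradiction (≅-sym (≅-linear R′≅ (isLinear K)) R≅R′) (≇-transport K L K≇L R′≅ R≅))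
      (λ S≅S′ → contradiction (≅-sym (≅-linear S′≅ (isLinear M)) S≅S′) (≇-transport M N M≇N S′≅ S≅))

theorem3p2 : ExcludedMiddle 0ℓ → ｛ ω · 𝟚 , ω ⋆ · 𝟚 ｝ ≤ᶜ ｛ ω² , ω² ⋆ ｝
theorem3p2 em = Γ , record
  { image = λ A A∈ → image A , image-isImage A (source-linear A A∈) , image-target em A A∈
  ; iso⇔  = λ {A} {A′} {B} {B′} A∈ A′∈ B-image B′-image →
      ≅⇔≅ (ω · 𝟚) (ω ⋆ · 𝟚) ω² (ω² ⋆) ω·2≇ω⋆·2 ω²≇ω²⋆
        (matching-types em A B A∈ (imageOf≅image A B A∈ B-image))
        (matching-types em A′ B′ A′∈ (imageOf≅image A′ B′ A′∈ B′-image))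
  }
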